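{- Let $G$ be a connected graph. Then $G$ is a $2$-$\chi_{ig}^{A}$-game-vertex-critical graph if and only if $G=K_2$. Likewise, $G$ is a $2$-$\chi_{ig}^{AB}$-game-vertex-critical graph if and only if $G=K_2$.
   Context: All graphs are simple, undirected and finite. The independence coloring game on a graph $G$ is played by Alice and Bob in rounds, round $i$ being played with color $i$ ($i=1,2,\ldots$). Within a round the players alternate moves, each move consisting of coloring a previously uncolored vertex with the color of the round so that the vertices colored in the same round form an independent set. A round is completed when no uncolored vertex can be given the color of the round (every uncolored vertex is adjacent to a vertex colored in this round). The game is over when all vertices are colored. Alice wants to finish in as few rounds as possible, Bob in as many rounds as possible. In the A-independence coloring game every round is started by Alice; the number of rounds when both players play optimally is the A-independence game chromatic number $\chi_{ig}^{A}(G)$. In the AB-independence coloring game Alice starts the first round and each further round is started by the player who did not make the last move of the previous round; the number of rounds when both players play optimally is the AB-independence game chromatic number $\chi_{ig}^{AB}(G)$. For $x\in V(G)$, $G-x$ is the graph obtained from $G$ by deleting $x$ and all edges incident with $x$. For $\varphi\in\{\chi_{ig}^{A},\chi_{ig}^{AB}\}$, a graph $G$ is $k$-$\varphi$-game-vertex-critical if $\varphi(G)=k$ and $\varphi(G-x)\neq\varphi(G)$ for every $x\in V(G)$. $K_n$ is the complete graph of order $n$; equality of graphs means isomorphism. -}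

module Defs where

open import Data.Bool.Base using (if_then_else_)
open import Data.Fin.Base using (Fin; punchIn)
open import Data.Fin.Properties using (all?; any?)
import Data.Fin.Properties as Fin
open import Data.List.Base using (List; []; _∷_; allFin; filter; map)
open import Data.List.Extrema.Nat using (min; max)
open import Data.Maybe.Base using (Maybe; just; nothing)
open import Data.Maybe.Properties using (≡-dec)
open import Data.Nat.Base using (ℕ; zero; suc; pred)
import Data.Nat.Properties as ℕ
open import Data.Product.Base using (_×_; Σ-syntax)
open import Data.Vec.Functional using (updateAt)
open import Function.Base using (const; _∘_)
open import Function.Bundles using (_↔_; _⇔_; Inverse)
open import Level using (0ℓ)
open import Relation.Binary.Construct.Closure.ReflexiveTransitive using (Star)
open import Relation.Binary.Core using (Rel)
open import Relation.Binary.Definitions using (Decidable; Irreflexive; Symmetric)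
open import Relation.Binary.PropositionalEquality.Core using (_≡_; _≢_; ≢-sym; cong)
open import Relation.Nullary.Decidable using (Dec; does; ¬?; _×-dec_; _→-dec_)

record Graph (n : ℕ) : Set₁ where
  field
    _~_      : Rel (Fin n) 0ℓ
    _~?_     : Decidable _~_
    ~-sym    : Symmetric _~_
    ~-irrefl : Irreflexive _≡_ _~_

Connected : ∀ {n} → Graph n → Set
Connected G = ∀ u v → Star (Graph._~_ G) u v

infix 4 _≅_

_≅_ : ∀ {m n} → Graph m → Graph n → Set
_≅_ {m} {n} G H =
  Σ[ f ∈ Fin m ↔ Fin n ]
    (∀ u v → Graph._~_ G u v ⇔ Graph._~_ H (Inverse.to f u) (Inverse.to f v))

K : ∀ n → Graph n
K n = record
  { _~_      = _≢_
  ; _~?_     = λ u v → ¬? (u Fin.≟ v)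
  ; ~-sym    = ≢-sym
  ; ~-irrefl = λ u≡v u≢v → u≢v u≡v
  }

infixl 6 _-_

-- The vertices other than x are renumbered along punchIn x.
_-_ : ∀ {n} → Graph n → Fin n → Graph (pred n)
_-_ {suc n} G x = record
  { _~_      = λ u v → punchIn x u ~ punchIn x v
  ; _~?_     = λ u v → punchIn x u ~? punchIn x v
  ; ~-sym    = ~-sym
  ; ~-irrefl = λ u≡v → ~-irrefl (cong (punchIn x) u≡v)
  }
  where open Graph G

data Player : Set where
  alice bob : Player

opponent : Player → Player
opponent alice = bob
opponent bob   = alice

-- Who starts a round, given who made the last move of the previous round.
-- (The first round is always started by Alice.)
StartRule : Set
StartRule = Player → Player

A-rule : StartRule
A-rule = const alice

AB-rule : StartRule
AB-rule = opponent

Colouring : ℕ → Set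
Colouring n = Fin n → Maybe ℕ

-- The colour of the round in progress is suc completed.
record Position (n : ℕ) : Set where
  constructor position
  field
    colouring : Colouring n
    completed : ℕ
    turn      : Player

initial : ∀ {n} → Position n
initial = position (const nothing) 0 alice

module Game {n} (G : Graph n) (rule : StartRule) where
  open Graph G

  Playable : Colouring n → ℕ → Fin n → Set
  Playable c i v = c v ≡ nothing × (∀ w → w ~ v → c w ≢ just i)

  playable? : ∀ c i v → Dec (Playable c i v)
  playable? c i v =
    ≡-dec ℕ._≟_ (c v) nothing ×-dec
    all? (λ w → (w ~? v) →-dec ¬? (≡-dec ℕ._≟_ (c w) (just i)))

  legalMoves : Position n → List (Fin n)
  legalMoves (position c r _) = filter (playable? c (suc r)) (allFin n)

  play : Position n → Fin n → Position n
  play (position c r t) v =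
    if does (any? (playable? c′ (suc r)))
    then position c′ r (opponent t)
    else position c′ (suc r) (rule t)
    where
    c′ : Colouring n
    c′ = updateAt c v (const (just (suc r)))

  optimum : Player → ℕ → List ℕ → ℕ
  optimum _     d []       = d
  optimum alice _ (k ∷ ks) = min k ks
  optimum bob   _ (k ∷ ks) = max k ks

  -- The total number of rounds under optimal play from the given position,
  -- by backward induction on the number of moves left to be made.  A position
  -- without a legal move is one in which the game is over: `play` starts the
  -- next round as soon as the current one is completed, and in a fresh round
  -- every uncoloured vertex is playable.
  rounds : ℕ → Position n → ℕ
  rounds zero    p = Position.completed p
  rounds (suc m) p =
    optimum (Position.turn p) (Position.completed p)
      (map (rounds m ∘ play p) (legalMoves p))

-- Each move colours exactly one vertex, so a game on n vertices consists of
-- exactly n moves.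
gameChromaticNumber : StartRule → ∀ {n} → Graph n → ℕ
gameChromaticNumber rule {n} G = Game.rounds G rule n initial

χᴬ : ∀ {n} → Graph n → ℕ
χᴬ = gameChromaticNumber A-rule

χᴬᴮ : ∀ {n} → Graph n → ℕ
χᴬᴮ = gameChromaticNumber AB-rule

GameVertexCritical : ℕ → (∀ {n} → Graph n → ℕ) → ∀ {n} → Graph n → Set
GameVertexCritical k φ G = φ G ≡ k × (∀ x → φ (G - x) ≢ φ G)

{-# OPTIONS --safe #-}

-- A connected graph with chromatic number 2 has a unique bipartition.  If
-- Alice's optimal opening move v had a non-neighbour u in the other part, Bob
-- would answer u and force a third round; so v is adjacent to exactly one end
-- of every edge.  Conversely, opening with such a v always lets Alice finish in
-- two rounds, and the condition on v survives the deletion of other vertices.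
-- If there are at least three vertices, deleting one outside some edge v y thus
-- keeps the number 2, so K₂ is the only critical graph.
module Submission where

open import Defs
open import Data.Empty using (⊥-elim)
open import Data.Fin.Base using (Fin; zero; suc; punchIn; punchOut)
open import Data.Fin.Permutation using (↔⇒≡)
open import Data.Fin.Properties
  using (any?; 0≢1+n; punchInᵢ≢i; punchIn-punchOut; punchIn-injective; _≟_)
open import Data.List.Base using (List; []; _∷_; allFin; filter; length; map)
open import Data.List.Extrema.Nat using (argmin-sel; argmax-sel; ⊥≤max; xs≤max; min≤⊤; min≤xs)
open import Data.List.Membership.Propositional using (_∈_; lose)
open import Data.List.Membership.Propositional.Properties
  using (∈-filter⁺; ∈-filter⁻; ∈-allFin; ∈-map⁺; ∈-map⁻)
open import Data.List.Properties using (length-tabulate; filter-notAll)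
import Data.List.Relation.Unary.All as All
open import Data.List.Relation.Unary.Any using (here; there)
open import Data.Maybe.Base using (just; nothing; fromMaybe)
open import Data.Maybe.Properties using (just-injective; ≡-dec)
open import Data.Nat.Base using (ℕ; zero; suc; _+_; _≤_; z≤n; s≤s; s≤s⁻¹)
open import Data.Nat.Properties as ℕ
  using (≤-refl; ≤-reflexive; ≤-trans; ≤-antisym; n≤1+n; m≤n⇒m≤1+n; +-suc; +-identityʳ; +-monoˡ-≤)
open import Data.Product.Base using (_×_; _,_; ∃; proj₁; proj₂)
open import Data.Sum.Base using (_⊎_; inj₁; inj₂)
open import Data.Vec.Functional using (updateAt)
open import Data.Vec.Functional.Properties using (updateAt-updates; updateAt-minimal)
open import Function.Base using (const; id; _∘_)
open import Function.Bundles using (_⇔_; mk⇔; Equivalence; Injection)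
open import Function.Construct.Identity using (↔-id)
open import Function.Properties.Inverse using (↔⇒↣)
open import Relation.Binary.Construct.Closure.ReflexiveTransitive using (Star; ε; _◅_)
open import Relation.Binary.PropositionalEquality
  using (_≡_; _≢_; refl; sym; trans; cong; subst; ≢-sym)
open import Relation.Nullary using (¬_; yes; no; contradiction)
open import Relation.Nullary.Decidable using (¬?)

-- Two colours

one-or-two : ∀ {k} → 1 ≤ k → k ≤ 2 → k ≡ 1 ⊎ k ≡ 2
one-or-two {1} _ _ = inj₁ refl
one-or-two {2} _ _ = inj₂ refl
one-or-two {suc (suc (suc _))} _ (s≤s (s≤s ()))

pigeonhole₂ : ∀ {a b c} → 1 ≤ a → a ≤ 2 → 1 ≤ b → b ≤ 2 → 1 ≤ c → c ≤ 2 →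
  a ≢ b → a ≢ c → b ≡ c
pigeonhole₂ 1≤a a≤2 1≤b b≤2 1≤c c≤2 a≢b a≢c
  with one-or-two 1≤a a≤2 | one-or-two 1≤b b≤2 | one-or-two 1≤c c≤2
... | inj₁ refl | inj₁ refl | _         = contradiction refl a≢b
... | inj₂ refl | inj₂ refl | _         = contradiction refl a≢b
... | inj₁ refl | inj₂ refl | inj₁ refl = contradiction refl a≢c
... | inj₁ refl | inj₂ refl | inj₂ refl = refl
... | inj₂ refl | inj₁ refl | inj₁ refl = refl
... | inj₂ refl | inj₁ refl | inj₂ refl = contradiction refl a≢c

-- Colouring one more vertex

module _ {n} (c : Colouring n) (v : Fin n) (k : ℕ) where

  private
    c′ : Colouring n
    c′ = updateAt c v (const (just k))

  paint-self : c′ v ≡ just k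
  paint-self = updateAt-updates v c

  paint-other : ∀ {w} → w ≢ v → c′ w ≡ c w
  paint-other {w} = updateAt-minimal w v c

  paint-just⁻ : ∀ {w i} → c′ w ≡ just i → (w ≡ v × i ≡ k) ⊎ c w ≡ just i
  paint-just⁻ {w} e with w ≟ v
  ... | yes refl = inj₁ (refl , just-injective (trans (sym e) paint-self))
  ... | no  w≢v  = inj₂ (trans (sym (paint-other w≢v)) e)

  paint-nothing⁻ : ∀ {w} → c′ w ≡ nothing → w ≢ v × c w ≡ nothing
  paint-nothing⁻ {w} e with w ≟ v
  ... | yes refl with () ← trans (sym e) paint-self
  ... | no  w≢v  = w≢v , trans (sym (paint-other w≢v)) e

  paint-just⁺ : ∀ {w i} → c v ≡ nothing → c w ≡ just i → c′ w ≡ just i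
  paint-just⁺ {w} cv e with w ≟ v
  ... | yes refl with () ← trans (sym cv) e
  ... | no  w≢v  = trans (paint-other w≢v) e

-- Vertices that split every edge

module _ {n} (G : Graph n) where
  open Graph G

  -- The neighbourhood of `v` and its complement are both independent: they form a bipartition in
  -- which `v` is adjacent to the whole opposite part.
  Splits : Fin n → Set
  Splits v = ∀ {u w} → u ~ w → (u ~ v ⊎ w ~ v) × ¬ (u ~ v × w ~ v)

  Proper : (Fin n → ℕ) → Set
  Proper f = ∀ {u w} → u ~ w → f u ≢ f w

  neighbour : ∀ {u w} → Star _~_ u w → u ≢ w → ∃ (u ~_)
  neighbour ε         u≢w = contradiction refl u≢w
  neighbour (u~j ◅ _) _   = _ , u~j

-- Moves and values of positions

module _ {n} (G : Graph n) (rule : StartRule) where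
  open Graph G
  open Game G rule
  open Position

  -- The conditional in `play` is resolved here once and for all; both outcomes carry the same
  -- colouring and differ only in round and turn.
  play-elim : (P : Position n → Set) → ∀ c r t v →
    let c′ = updateAt c v (const (just (suc r))) in
    (∃ (Playable c′ (suc r)) → P (position c′ r (opponent t))) →
    (¬ ∃ (Playable c′ (suc r)) → P (position c′ (suc r) (rule t))) →
    P (play (position c r t) v)
  play-elim P c r t v continue next
    with any? (playable? (updateAt c v (const (just (suc r)))) (suc r))
  ... | yes ∃u = continue ∃u
  ... | no  ∄u = next ∄u

  Legal : Position n → Fin n → Set
  Legal p = Playable (colouring p) (suc (completed p))

  legal⁺ : ∀ p {v} → Legal p v → v ∈ legalMoves p
  legal⁺ p = ∈-filter⁺ (playable? (colouring p) (suc (completed p))) (∈-allFin _)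

  legal⁻ : ∀ p {v} → v ∈ legalMoves p → Legal p v
  legal⁻ p v∈ = proj₂ (∈-filter⁻ (playable? (colouring p) (suc (completed p))) {xs = allFin n} v∈)

  optimum-sel : ∀ t d ks → (ks ≡ [] × optimum t d ks ≡ d) ⊎ optimum t d ks ∈ ks
  optimum-sel t     d []       = inj₁ (refl , refl)
  optimum-sel alice d (k ∷ ks) with argmin-sel id k ks
  ... | inj₁ e = inj₂ (here e)
  ... | inj₂ i = inj₂ (there i)
  optimum-sel bob   d (k ∷ ks) with argmax-sel id k ks
  ... | inj₁ e = inj₂ (here e)
  ... | inj₂ i = inj₂ (there i)

  optimum-alice : ∀ {d k} ks → k ∈ ks → optimum alice d ks ≤ k
  optimum-alice (k ∷ ks) (here refl) = min≤⊤ k ks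
  optimum-alice (k ∷ ks) (there i)   = All.lookup (min≤xs k ks) i

  optimum-bob : ∀ {d k} ks → k ∈ ks → k ≤ optimum bob d ks
  optimum-bob (k ∷ ks) (here refl) = ⊥≤max k ks
  optimum-bob (k ∷ ks) (there i)   = All.lookup (xs≤max k ks) i

  -- A minimum or maximum over a nonempty list is one of its entries, so some legal move realises
  -- the value whoever is on turn. The first alternative is the default of `optimum` on an empty
  -- list.
  rounds-attained : ∀ m p →
    ((∀ v → ¬ Legal p v) × rounds (suc m) p ≡ completed p) ⊎
    (∃ λ v → Legal p v × rounds (suc m) p ≡ rounds m (play p v))
  rounds-attained m p
    with optimum-sel (turn p) (completed p) (map (rounds m ∘ play p) (legalMoves p))
  ... | inj₁ (none , e) = inj₁ (stuck , e)
    where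
    stuck : ∀ v → ¬ Legal p v
    stuck v lv with () ← subst (rounds m (play p v) ∈_) none (∈-map⁺ (rounds m ∘ play p) (legal⁺ p lv))
  ... | inj₂ i with v , v∈ , e ← ∈-map⁻ (rounds m ∘ play p) i = inj₂ (v , legal⁻ p v∈ , e)

  rounds-alice : ∀ m c r {v} → Legal (position c r alice) v →
    rounds (suc m) (position c r alice) ≤ rounds m (play (position c r alice) v)
  rounds-alice m c r l =
    optimum-alice _ (∈-map⁺ (rounds m ∘ play p) (legal⁺ p l))
    where p = position c r alice

  rounds-bob : ∀ m c r {v} → Legal (position c r bob) v →
    rounds m (play (position c r bob) v) ≤ rounds (suc m) (position c r bob)
  rounds-bob m c r l =
    optimum-bob _ (∈-map⁺ (rounds m ∘ play p) (legal⁺ p l))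
    where p = position c r bob

  completed≤rounds : ∀ m p → completed p ≤ rounds m p
  completed≤rounds zero    p = ≤-refl
  completed≤rounds (suc m) p@(position c r t) with rounds-attained m p
  ... | inj₁ (_ , e)     = ≤-reflexive (sym e)
  ... | inj₂ (v , _ , e) = subst (r ≤_) (sym e)
    (≤-trans (play-elim (λ q → r ≤ completed q) c r t v (λ _ → ≤-refl) (λ _ → n≤1+n r))
             (completed≤rounds m (play p v)))

  -- A single move completes at most one round.
  rounds≤completed+moves : ∀ m p → rounds m p ≤ completed p + m
  rounds≤completed+moves zero    p = ≤-reflexive (sym (+-identityʳ _))
  rounds≤completed+moves (suc m) p@(position c r t) with rounds-attained m p
  ... | inj₁ (_ , e)     = subst (_≤ r + suc m) (sym e) (ℕ.m≤m+n r (suc m))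
  ... | inj₂ (v , _ , e) = subst (_≤ r + suc m) (sym e)
    (≤-trans (rounds≤completed+moves m (play p v))
    (≤-trans (+-monoˡ-≤ m (play-elim (λ q → completed q ≤ suc r) c r t v (λ _ → n≤1+n r) (λ _ → ≤-refl)))
             (≤-reflexive (sym (+-suc r m)))))

  χ≤order : gameChromaticNumber rule G ≤ n
  χ≤order = rounds≤completed+moves n initial

  -- A splitting opening finishes in two rounds

  -- `P` is an invariant under every legal move of either player, so it holds along the line of play
  -- that attains the value.
  rounds-bounded : ∀ {b} (P : Position n → Set) →
    (∀ {p v} → P p → Legal p v → P (play p v)) →
    (∀ {p} → P p → completed p ≤ b) →
    ∀ m {p} → P p → rounds m p ≤ b
  rounds-bounded P step bound zero    Pp = bound Pp
  rounds-bounded P step bound (suc m) {p} Pp with rounds-attained m p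
  ... | inj₁ (_ , e)     = ≤-trans (≤-reflexive e) (bound Pp)
  ... | inj₂ (v , l , e) = ≤-trans (≤-reflexive e) (rounds-bounded P step bound m (step Pp l))

  -- The invariant after Alice opens with `v`: round one consumes exactly the non-neighbours of `v`,
  -- and round two its neighbours.
  data TwoRounds (v : Fin n) : Position n → Set where
    first  : ∀ {c t} → c v ≡ just 1 → (∀ {w} → w ~ v → c w ≡ nothing) →
             (∀ {w} → c w ≢ just 2) → TwoRounds v (position c 0 t)
    second : ∀ {c t} → (∀ {w} → c w ≡ nothing → w ~ v) →
             (∀ {w} → c w ≡ just 2 → w ~ v) → TwoRounds v (position c 1 t)
    over   : ∀ {c t} → (∀ {w} → c w ≢ nothing) → TwoRounds v (position c 2 t)

  module _ {v} (splits : Splits G v) where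

    -- The assumptions concern the colouring after the move, so that the opening move itself is
    -- covered as well as later moves of round one.
    twoRounds-first : ∀ c t u → let c′ = updateAt c u (const (just 1)) in
      c′ v ≡ just 1 → (∀ {w} → w ~ v → c′ w ≡ nothing) → (∀ {w} → c′ w ≢ just 2) →
      TwoRounds v (play (position c 0 t) u)
    twoRounds-first c t u v₁ free no₂ = play-elim (TwoRounds v) c 0 t u
      (λ _ → first v₁ free no₂)
      (λ ∄ → second (λ {w} e → uncoloured ∄ w e) (λ e → contradiction e no₂))
      where
      c′ = updateAt c u (const (just 1))

      uncoloured : ¬ ∃ (Playable c′ 1) → ∀ w → c′ w ≡ nothing → w ~ v
      uncoloured ∄ w e with w ~? v
      ... | yes w~v = w~v
      ... | no  w≁v = contradiction (w , e , avoid) ∄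
        where
        avoid : ∀ x → x ~ w → c′ x ≢ just 1
        -- An uncoloured non-neighbour `w` of `v` stays playable: by `splits` each of its neighbours
        -- is adjacent to `v`, hence still uncoloured.
        avoid x x~w x₁ with proj₁ (splits x~w)
        ... | inj₂ w~v = w≁v w~v
        ... | inj₁ x~v with () ← trans (sym x₁) (free x~v)

    twoRounds-step : ∀ {p u} → TwoRounds v p → Legal p u → TwoRounds v (play p u)
    twoRounds-step {position c _ t} {u} (first v₁ free no₂) (cu , ind) =
      twoRounds-first c t u (paint-just⁺ c u 1 cu v₁) free′ no₂′
      where
      free′ : ∀ {w} → w ~ v → updateAt c u (const (just 1)) w ≡ nothing
      -- A neighbour of `v` cannot be the vertex `u` just played, because `v` already has colour 1.
      free′ {w} w~v = trans (paint-other c u 1 λ { refl → ind v (~-sym w~v) v₁ }) (free w~v)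

      no₂′ : ∀ {w} → updateAt c u (const (just 1)) w ≢ just 2
      no₂′ e with paint-just⁻ c u 1 e
      ... | inj₁ (_ , ())
      ... | inj₂ e′ = no₂ e′
    twoRounds-step {position c _ t} {u} (second un two) (cu , _) =
      play-elim (TwoRounds v) c 1 t u
        (λ _ → second un′ two′)
        -- An uncoloured `w` with a neighbour of colour 2 would give an edge with both ends adjacent
        -- to `v`; so round two ends only when everything is coloured.
        (λ ∄ → over λ {w} e → ∄ (w , e , λ x x~w x₂ →
          proj₂ (splits x~w) (two′ x₂ , un′ e)))
      where
      un′ : ∀ {w} → updateAt c u (const (just 2)) w ≡ nothing → w ~ v
      un′ e = un (proj₂ (paint-nothing⁻ c u 2 e))

      two′ : ∀ {w} → updateAt c u (const (just 2)) w ≡ just 2 → w ~ v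
      two′ e with paint-just⁻ c u 2 e
      ... | inj₁ (refl , _) = un cu
      ... | inj₂ e′         = two e′
    twoRounds-step (over coloured) (cu , _) = contradiction cu coloured

  -- Alice's minimum is at most the value of opening with `v`. Matching on the equation for `n`
  -- exposes this first move in `rounds n`.
  splits⇒χ≤2 : ∀ {m v} → n ≡ suc m → Splits G v → gameChromaticNumber rule G ≤ 2
  splits⇒χ≤2 {m} {v} refl splits =
    ≤-trans (rounds-alice m (const nothing) 0 {v} (refl , λ _ _ ()))
      (rounds-bounded (TwoRounds v) (twoRounds-step splits) bound m
        (twoRounds-first splits _ alice v (paint-self _ v 1)
          (λ w~v → paint-other _ v 1 λ { refl → ~-irrefl refl w~v }) no₂))
    where
    bound : ∀ {p} → TwoRounds v p → completed p ≤ 2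
    bound (first _ _ _) = z≤n
    bound (second _ _)  = s≤s z≤n
    bound (over _)      = ≤-refl

    no₂ : ∀ {w} → updateAt (const nothing) v (const (just 1)) w ≢ just 2
    no₂ e with paint-just⁻ (const nothing) v 1 e
    ... | inj₁ (_ , ())
    ... | inj₂ ()

  -- Proper colourings produced by play

  -- The invariant of reachable positions with `m` moves left. The list `remaining` bounds the
  -- number of uncoloured vertices without an exact count. In the second case of `live` the game is
  -- over and the last round is already counted, so the bound on colours drops by one.
  record Valid (m : ℕ) (p : Position n) : Set where
    field
      proper     : ∀ {u w i} → u ~ w → colouring p u ≡ just i → colouring p w ≢ just i
      positive   : ∀ {u i} → colouring p u ≡ just i → 1 ≤ i
      bounded    : ∀ {u i} → colouring p u ≡ just i → i ≤ suc (completed p)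
      remaining  : List (Fin n)
      enough     : length remaining ≤ m
      uncoloured : ∀ {u} → colouring p u ≡ nothing → u ∈ remaining
      live       : ∃ (Legal p) ⊎
                   (∀ {u} → colouring p u ≢ nothing) ×
                   (∀ {u i} → colouring p u ≡ just i → i ≤ completed p)

  valid-zero : ∀ {p u} → Valid 0 p → colouring p u ≢ nothing
  valid-zero V cu with Valid.remaining V | Valid.enough V | Valid.uncoloured V cu
  ... | [] | _ | ()

  valid-initial : ∀ {m} → n ≡ suc m → Valid n initial
  valid-initial refl = record
    { proper     = λ _ ()
    ; positive   = λ ()
    ; bounded    = λ ()
    ; remaining  = allFin n
    ; enough     = ≤-reflexive (length-tabulate id)
    ; uncoloured = λ _ → ∈-allFin _
    ; live       = inj₁ (zero , refl , λ _ _ ())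
    }

  valid-play : ∀ {m p v} → Valid (suc m) p → Legal p v → Valid m (play p v)
  valid-play {m} {position c r t} {v} V (cv , ind) = play-elim (Valid m) c r t v
    (λ ∃u → record
      { proper = proper′ ; positive = positive′ ; bounded = bounded′
      ; remaining = remaining′ ; enough = enough′ ; uncoloured = uncoloured′
      ; live = inj₁ ∃u })
    (λ _ → record
      { proper = proper′ ; positive = positive′ ; bounded = m≤n⇒m≤1+n ∘ bounded′
      ; remaining = remaining′ ; enough = enough′ ; uncoloured = uncoloured′
      ; live = live′ })
    where
    open Valid V
    c′ = updateAt c v (const (just (suc r)))

    proper′ : ∀ {u w i} → u ~ w → c′ u ≡ just i → c′ w ≢ just i
    proper′ u~w eu ew with paint-just⁻ c v (suc r) eu | paint-just⁻ c v (suc r) ew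
    ... | inj₁ (refl , _)    | inj₁ (refl , _)    = ~-irrefl refl u~w
    ... | inj₁ (refl , refl) | inj₂ ew′           = ind _ (~-sym u~w) ew′
    ... | inj₂ eu′           | inj₁ (refl , refl) = ind _ u~w eu′
    ... | inj₂ eu′           | inj₂ ew′           = proper u~w eu′ ew′

    positive′ : ∀ {u i} → c′ u ≡ just i → 1 ≤ i
    positive′ e with paint-just⁻ c v (suc r) e
    ... | inj₁ (_ , refl) = s≤s z≤n
    ... | inj₂ e′         = positive e′

    bounded′ : ∀ {u i} → c′ u ≡ just i → i ≤ suc r
    bounded′ e with paint-just⁻ c v (suc r) e
    ... | inj₁ (_ , refl) = ≤-refl
    ... | inj₂ e′         = bounded e′

    remaining′ = filter (λ u → ¬? (u ≟ v)) remaining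

    enough′ : length remaining′ ≤ m
    enough′ = s≤s⁻¹ (≤-trans
      -- The played vertex `v` is in the list and fails the filter, so the list becomes strictly
      -- shorter.
      (filter-notAll (λ u → ¬? (u ≟ v)) remaining (lose (uncoloured cv) (λ v≢v → v≢v refl)))
      enough)

    uncoloured′ : ∀ {u} → c′ u ≡ nothing → u ∈ remaining′
    uncoloured′ e with u≢v , e′ ← paint-nothing⁻ c v (suc r) e =
      ∈-filter⁺ (λ u → ¬? (u ≟ v)) (uncoloured e′) u≢v

    live′ : ∃ (Playable c′ (suc (suc r))) ⊎
            (∀ {u} → c′ u ≢ nothing) × (∀ {u i} → c′ u ≡ just i → i ≤ suc r)
    live′ with any? (λ u → ≡-dec ℕ._≟_ (c′ u) nothing)
    -- The next colour exceeds all colours in use, so every uncoloured vertex is playable in the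
    -- fresh round.
    ... | yes (u , e) = inj₁ (u , e , λ w _ ew → ℕ.1+n≰n (bounded′ ew))
    ... | no  ∄       = inj₂ ((λ e → ∄ (_ , e)) , bounded′)

  -- A proper colouring of all of `G` with colours 1 to `k` that extends the partial colouring `c`.
  record Completion (c : Colouring n) (k : ℕ) : Set where
    field
      colour   : Fin n → ℕ
      extends  : ∀ {u i} → c u ≡ just i → colour u ≡ i
      proper   : Proper G colour
      positive : ∀ u → 1 ≤ colour u
      bounded  : ∀ u → colour u ≤ k

  -- Following an optimal line of play to its end colours all vertices properly, with one colour per
  -- round. This turns bounds on the game value into statements about ordinary colourings.
  completion : ∀ m {p} → Valid m p → Completion (colouring p) (rounds m p)
  completion m {p} V with Valid.live V
  completion m {p} V | inj₂ (coloured , ≤completed) = record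
    { colour   = colour
    ; extends  = λ e → cong (fromMaybe 0) e
    ; proper   = λ {_} {w} u~w e →
        Valid.proper V u~w (is-just _) (trans (is-just w) (cong just (sym e)))
    ; positive = λ u → Valid.positive V (is-just u)
    ; bounded  = λ u → ≤-trans (≤completed (is-just u)) (completed≤rounds m p)
    }
    where
    -- The default 0 is never taken, since here every vertex is coloured.
    colour = fromMaybe 0 ∘ colouring p

    is-just : ∀ u → colouring p u ≡ just (colour u)
    is-just u with colouring p u in e
    ... | just _  = refl
    ... | nothing = contradiction e coloured
  completion zero V | inj₁ (u , cu , _) = contradiction cu (valid-zero V)
  completion (suc m) {p} V | inj₁ (u , lu) with rounds-attained m p
  ... | inj₁ (stuck , _) = contradiction lu (stuck u)
  ... | inj₂ (v , lv , e) = record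
    { colour   = colour
    ; extends  = λ cu → extends (kept cu)
    ; proper   = proper
    ; positive = positive
    ; bounded  = λ u → subst (colour u ≤_) (sym e) (bounded u)
    }
    where
    open Completion (completion m (valid-play V lv))

    kept : ∀ {u i} → colouring p u ≡ just i → colouring (play p v) u ≡ just i
    kept {u} {i} cu = play-elim (λ q → colouring q u ≡ just i) _ _ _ v (λ _ → e′) (λ _ → e′)
      where e′ = paint-just⁺ (colouring p) v _ (proj₁ lv) cu

  edge⇒2≤χ : ∀ {m u w} → n ≡ suc m → u ~ w → 2 ≤ gameChromaticNumber rule G
  edge⇒2≤χ {u = u} {w} n≡ u~w = distinct⇒2≤ (positive u) (bounded u) (positive w) (bounded w) (proper u~w)
    where
    open Completion (completion n (valid-initial n≡))

    distinct⇒2≤ : ∀ {a b k} → 1 ≤ a → a ≤ k → 1 ≤ b → b ≤ k → a ≢ b → 2 ≤ k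
    distinct⇒2≤ {k = suc (suc _)} _ _ _ _ _ = s≤s (s≤s z≤n)
    distinct⇒2≤ {k = 0} 1≤a a≤0 _ _ _ with () ← ≤-trans 1≤a a≤0
    distinct⇒2≤ {k = 1} 1≤a a≤1 1≤b b≤1 a≢b =
      contradiction (trans (≤-antisym a≤1 1≤a) (≤-antisym 1≤b b≤1)) a≢b

  -- Uniqueness of the bipartition and optimal openings

  -- With only two colours, each colour along a walk is forced by the one before it.
  completions-agree : ∀ {c d} (C : Completion c 2) (D : Completion d 2) →
    let open Completion in ∀ {v u} → Star _~_ v u →
    colour C v ≡ colour D v → colour C u ≡ colour D u
  completions-agree C D ε e = e
  completions-agree C D (_◅_ {i = v} {j = w} v~w path) e = completions-agree C D path
    (pigeonhole₂ (positive C v) (bounded C v) (positive C w) (bounded C w) (positive D w) (bounded D w)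
      (proper C v~w) (λ e′ → proper D v~w (trans (sym e) e′)))
    where open Completion

  widen : ∀ {c k l} → k ≤ l → Completion c k → Completion c l
  widen k≤l C = record
    { colour = colour ; extends = extends ; proper = proper ; positive = positive
    ; bounded = λ u → ≤-trans (bounded u) k≤l }
    where open Completion C

  -- Optimal play after `v` yields a 2-colouring `C` with `v` of colour 1. It remains to see that
  -- every vertex of colour 2 is adjacent to `v`; otherwise Bob's reply there leads to a second,
  -- incompatible 2-colouring.
  winning-opening-splits : ∀ {m} → Connected G → Valid (suc m) initial → ∀ {v} →
    rounds m (play initial v) ≤ 2 → Splits G v
  winning-opening-splits {m} conn V {v} ≤2 = splits
    where
    opened : Colouring n
    opened = updateAt (const nothing) v (const (just 1))

    V₁ : Valid m (play initial v)
    V₁ = valid-play V (refl , λ _ _ ())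

    opened-kept : ∀ {u} → colouring (play initial v) u ≡ opened u
    opened-kept {u} =
      play-elim (λ q → colouring q u ≡ opened u) (const nothing) 0 alice v (λ _ → refl) (λ _ → refl)

    C : Completion (colouring (play initial v)) 2
    C = widen ≤2 (completion m V₁)

    open Completion C

    colour-v : colour v ≡ 1
    colour-v = extends (trans opened-kept (paint-self (const nothing) v 1))

    other-part-adjacent : ∀ {u} → colour u ≡ 2 → u ~ v
    other-part-adjacent {u} u₂ with u ~? v
    ... | yes u~v = u~v
    ... | no  u≁v = ⊥-elim (reply m (subst (Valid m) bob-to-move V₁)
      (subst (λ p → rounds m p ≤ 2) bob-to-move ≤2))
      where
      u≢v : u ≢ v
      u≢v refl with () ← trans (sym u₂) colour-v

      playable : Playable opened 1 u
      playable = paint-other (const nothing) v 1 u≢v , avoid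
        where
        avoid : ∀ w → w ~ u → opened w ≢ just 1
        avoid w w~u e with paint-just⁻ (const nothing) v 1 e
        ... | inj₁ (refl , _) = u≁v (~-sym w~u)
        ... | inj₂ ()

      -- Round one cannot be over, as `u` is still playable.
      bob-to-move : play initial v ≡ position opened 0 bob
      bob-to-move = play-elim (_≡ position opened 0 bob) (const nothing) 0 alice v
        (λ _ → refl) (λ ∄ → contradiction (u , playable) ∄)

      -- The case split on the number of moves left exposes Bob's maximum; none left is impossible
      -- while `u` is uncoloured.
      reply : ∀ m → Valid m (position opened 0 bob) → ¬ rounds m (position opened 0 bob) ≤ 2
      reply zero    W ≤2 = valid-zero W (proj₁ playable)
      reply (suc m) W ≤2 = contradiction (trans (sym u₂) (trans agree D-u)) λ ()
        where
        D : Completion (colouring (play (position opened 0 bob) u)) 2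
        D = widen (≤-trans (rounds-bob m opened 0 playable) ≤2) (completion m (valid-play W playable))

        replied : Colouring n
        replied = updateAt opened u (const (just 1))

        replied-kept : ∀ {w} → replied w ≡ just 1 → Completion.colour D w ≡ 1
        replied-kept {w} e = Completion.extends D
          (play-elim (λ q → colouring q w ≡ just 1) opened 0 bob u (λ _ → e) (λ _ → e))

        D-u : Completion.colour D u ≡ 1
        D-u = replied-kept (paint-self opened u 1)

        D-v : Completion.colour D v ≡ 1
        D-v = replied-kept (paint-just⁺ opened u 1 (proj₁ playable) (paint-self (const nothing) v 1))

        -- Both colourings give `v` colour 1, so they coincide at `u`; but `C` gives `u` colour 2
        -- and `D` gives it colour 1.
        agree : colour u ≡ Completion.colour D u
        agree = completions-agree C D (conn v u) (trans colour-v (sym D-v))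

    splits : Splits G v
    splits {u} {w} u~w with one-or-two (positive u) (bounded u) | one-or-two (positive w) (bounded w)
    ... | inj₁ u₁ | inj₁ w₁ = contradiction (trans u₁ (sym w₁)) (proper u~w)
    ... | inj₂ u₂ | inj₂ w₂ = contradiction (trans u₂ (sym w₂)) (proper u~w)
    ... | inj₁ u₁ | inj₂ w₂ =
      -- The end of colour 2 is adjacent to `v`; the end of colour 1 is not, as it shares its colour
      -- with `v`.
      inj₂ (other-part-adjacent w₂) , λ (u~v , _) → proper u~v (trans u₁ (sym colour-v))
    ... | inj₂ u₂ | inj₁ w₁ =
      inj₁ (other-part-adjacent u₂) , λ (_ , w~v) → proper w~v (trans w₁ (sym colour-v))

  χ≡2⇒splits : ∀ {m} → n ≡ suc m → Connected G → gameChromaticNumber rule G ≡ 2 → ∃ (Splits G)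
  χ≡2⇒splits {m} refl conn χ≡2 with rounds-attained m initial
  -- Without a legal move the value would be the number of completed rounds, which is 0.
  ... | inj₁ (_ , e) with () ← trans (sym e) χ≡2
  ... | inj₂ (v , _ , e) =
    v , winning-opening-splits conn (valid-initial refl) (≤-reflexive (trans (sym e) χ≡2))

-- Vertex deletion and critical graphs

third : ∀ {k} {v y : Fin (3 + k)} → v ≢ y → ∃ λ z → z ≢ v × z ≢ y
third {v = v} {y} v≢y = z , punchInᵢ≢i v _ , z≢y
  where
  -- Remove `v`, then `y` from what is left: the first remaining vertex, renumbered back.
  z = punchIn v (punchIn (punchOut v≢y) zero)

  z≢y : z ≢ y
  z≢y e = punchInᵢ≢i (punchOut v≢y) zero
    (punchIn-injective v _ _ (trans e (sym (punchIn-punchOut v≢y))))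

-- χ is kept abstract because the type checker would otherwise unfold the game
-- on graphs whose order is a successor.
module Critical
  (χ : ∀ {n} → Graph n → ℕ)
  (χ≤n : ∀ {n} (G : Graph n) → χ G ≤ n)
  (splits⇒≤2 : ∀ {m} (G : Graph (suc m)) {v} → Splits G v → χ G ≤ 2)
  (edge⇒≥2 : ∀ {m} (G : Graph (suc m)) {u w} → Graph._~_ G u w → 2 ≤ χ G)
  (≡2⇒splits : ∀ {m} (G : Graph (suc m)) → Connected G → χ G ≡ 2 → ∃ (Splits G))
  where

  -- Edges of `G - z` are edges of `G`, so `v` still splits them, and the edge from `v` to `y`
  -- survives to force two colours.
  deletion-2 : ∀ {k} (G : Graph (3 + k)) {v y z} → Splits G v → Graph._~_ G v y →
    z ≢ v → z ≢ y → χ (G - z) ≡ 2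
  deletion-2 G {v} {y} {z} splits v~y z≢v z≢y = ≤-antisym
    (splits⇒≤2 (G - z) {v = punchOut z≢v}
      (subst (Splits G) (sym (punchIn-punchOut z≢v)) splits))
    (edge⇒≥2 (G - z) {punchOut z≢v} {punchOut z≢y} edge)
    where
    open Graph G
    edge : punchIn z (punchOut z≢v) ~ punchIn z (punchOut z≢y)
    edge rewrite punchIn-punchOut z≢v | punchIn-punchOut z≢y = v~y

  deletable : ∀ {k} (G : Graph (3 + k)) → Connected G → χ G ≡ 2 → ∃ λ z → χ (G - z) ≡ 2
  deletable G conn χ≡2 =
    let v , splits    = ≡2⇒splits G conn χ≡2
        -- The vertex `punchIn v zero` is merely some vertex other than `v`; the first step of a
        -- walk towards it supplies the neighbour `y`.
        y , v~y       = neighbour G (conn v (punchIn v zero)) (≢-sym (punchInᵢ≢i v zero))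
        z , z≢v , z≢y = third (λ v≡y → Graph.~-irrefl G v≡y v~y)
    in  z , deletion-2 G splits v~y z≢v z≢y

  order-2⇒K₂ : (G : Graph 2) → Connected G → G ≅ K 2
  order-2⇒K₂ G conn = ↔-id _ , λ u w → mk⇔ (λ u~w u≡w → ~-irrefl u≡w u~w) (adjacent u w)
    where
    open Graph G

    0~1 : zero ~ suc zero
    0~1 with neighbour G (conn zero (suc zero)) 0≢1+n
    ... | zero     , 0~0 = contradiction 0~0 (~-irrefl refl)
    ... | suc zero , 0~1 = 0~1

    adjacent : ∀ u w → u ≢ w → u ~ w
    adjacent zero       zero       u≢w = contradiction refl u≢w
    adjacent zero       (suc zero) _   = 0~1
    adjacent (suc zero) zero       _   = ~-sym 0~1
    adjacent (suc zero) (suc zero) u≢w = contradiction refl u≢w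

  critical⇒K₂ : ∀ n (G : Graph n) → Connected G → GameVertexCritical 2 χ G → G ≅ K 2
  critical⇒K₂ 0 G _ (χ≡2 , _) with () ← subst (_≤ 0) χ≡2 (χ≤n G)
  critical⇒K₂ 1 G _ (χ≡2 , _) with s≤s () ← subst (_≤ 1) χ≡2 (χ≤n G)
  critical⇒K₂ 2 G conn _ = order-2⇒K₂ G conn
  critical⇒K₂ (suc (suc (suc k))) G conn (χ≡2 , crit) =
    let z , e = deletable G conn χ≡2 in contradiction (trans e (sym χ≡2)) (crit z)

  -- On two vertices the bound by the order meets the lower bound from the edge; after a deletion
  -- one vertex is left and the order bounds the value by 1.
  K₂⇒critical : ∀ n (G : Graph n) → G ≅ K 2 → GameVertexCritical 2 χ G
  K₂⇒critical n G (f , iso) with refl ← ↔⇒≡ f = χ≡2 , crit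
    where
    0~1 : Graph._~_ G zero (suc zero)
    0~1 = Equivalence.from (iso zero (suc zero)) (0≢1+n ∘ Injection.injective (↔⇒↣ f))

    χ≡2 : χ G ≡ 2
    χ≡2 = ≤-antisym (χ≤n G) (edge⇒≥2 G 0~1)

    crit : ∀ x → χ (G - x) ≢ χ G
    crit x e with s≤s () ← subst (_≤ 1) (trans e χ≡2) (χ≤n (G - x))

  critical⇔≅K₂ : ∀ n (G : Graph n) → Connected G → GameVertexCritical 2 χ G ⇔ G ≅ K 2
  critical⇔≅K₂ n G conn = mk⇔ (critical⇒K₂ n G conn) (K₂⇒critical n G)

-- All bounds hold whoever starts the rounds after the first, so one argument serves both versions
-- of the game.
critical⇔K₂ : ∀ rule n (G : Graph n) → Connected G →
  GameVertexCritical 2 (gameChromaticNumber rule) G ⇔ G ≅ K 2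
critical⇔K₂ rule = Critical.critical⇔≅K₂ (gameChromaticNumber rule)
  (λ G → χ≤order G rule)
  (λ G → splits⇒χ≤2 G rule refl)
  (λ G → edge⇒2≤χ G rule refl)
  (λ G → χ≡2⇒splits G rule refl)

proposition22 : ∀ (n : ℕ) (G : Graph n) → Connected G →
    (GameVertexCritical 2 χᴬ G ⇔ G ≅ K 2) × (GameVertexCritical 2 χᴬᴮ G ⇔ G ≅ K 2)
proposition22 n G conn = critical⇔K₂ A-rule n G conn , critical⇔K₂ AB-rule n G conn
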